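{- Let $n\ge 3$ and let $p,p'$ be integers with $2\le p\le n-1$ and $p+p'=n+1$. For $1\le q\le n-1$ let $C_q=(n,1,\ldots,q-1,n-1,q,\ldots,n-2)\in\mathfrak{S}_n$, and for $g\ge 0$ let $N_{q}(g)$ be the number of $n$-cycles $\sigma\in\mathfrak{S}_n$ with $\sigma^{ -1}(n)=n-1$ such that $\sigma C_q$ has exactly $n-2g$ cycles (the number of $(q,n-1,n)$-dipoles on the orientable surface of genus $g$). Then $N_p(g)=N_{p'}(g)$ for every $g\ge 0$.
   Context: Combinatorial meaning: a dipole is a 2-cell embedding in an orientable surface of a loopless graph with exactly two vertices, rooted at a vertex and an edge (labelled $n$), with a second distinguished edge (labelled $n-1$), the other edges labelled canonically. $C_q$ is the counterclockwise rotation at the root vertex (root jump, i.e. one plus the number of edges strictly between the root edge and the distinguished edge counterclockwise around the root vertex, equal to $q$) and $\sigma$ the rotation at the non-root vertex (non-root jump $n-1$); faces correspond to cycles of $\sigma C_q$, and a dipole with $n$ edges and $m$ faces lies on the orientable surface of genus $\frac12(n-m)$. -}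

module Defs where

open import Data.Nat using (ℕ; zero; suc; _+_; _*_; _∸_; _≤ᵇ_; _≡ᵇ_)
open import Data.Bool using (Bool; true; false; _∧_; if_then_else_)
open import Data.List using (List; []; _∷_; _++_; map; concatMap; filter; length; upTo)
open import Data.Bool.ListAction using (all; any)
open import Data.Bool.Properties using (T?)

-- Elements of [n] = {1,…,n} are represented by the natural numbers 1,…,n.

labels : ℕ → List ℕ
labels n = map suc (upTo n)

-- The list [a, a+1, …, b] (empty if b < a).
range : ℕ → ℕ → List ℕ
range a b = map (a +_) (upTo (suc b ∸ a))

words : ℕ → ℕ → List (List ℕ)
words n zero    = [] ∷ []
words n (suc k) = concatMap (λ x → map (x ∷_) (words n k)) (labels n)

-- A word w = [σ(1), …, σ(n)] read as a map on labels: apply w i = σ(i)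
-- (i-th entry, 1-based; identity outside the word).
apply : List ℕ → ℕ → ℕ
apply []      i             = i
apply (x ∷ w) zero          = zero
apply (x ∷ w) (suc zero)    = x
apply (x ∷ w) (suc (suc i)) = apply w (suc i)

-- w (of length n, entries in [n]) is a permutation of [n]: injective on [n].
isPerm : ℕ → List ℕ → Bool
isPerm n w = all (λ i → all (λ j → if apply w i ≡ᵇ apply w j then i ≡ᵇ j else true) (labels n)) (labels n)

iter : (ℕ → ℕ) → ℕ → ℕ → ℕ
iter f zero    x = x
iter f (suc k) x = f (iter f k x)

cyclePerm : List ℕ → ℕ → ℕ
cyclePerm []        x = x
cyclePerm (c ∷ cs) x = go (c ∷ cs)
  where
  go : List ℕ → ℕ
  go []            = x
  go (a ∷ [])      = if a ≡ᵇ x then c else x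
  go (a ∷ b ∷ rest) = if a ≡ᵇ x then b else go (b ∷ rest)

Cq : ℕ → ℕ → ℕ → ℕ
Cq n q = cyclePerm (n ∷ (range 1 (q ∸ 1) ++ ((n ∸ 1) ∷ range q (n ∸ 2))))

-- Number of cycles of a permutation f of [n]: each cycle is counted
-- once, via its least element i (i ≤ f^k(i) for all k < n).
cycleCount : ℕ → (ℕ → ℕ) → ℕ
cycleCount n f = length (filter (λ i → T? (all (λ k → i ≤ᵇ iter f k i) (upTo n))) (labels n))

isNCycle : ℕ → (ℕ → ℕ) → Bool
isNCycle n f = all (λ j → any (λ k → iter f k n ≡ᵇ j) (upTo n)) (labels n)

-- N_q(g): number of n-cycles σ ∈ 𝔖_n with σ⁻¹(n) = n-1 (i.e. σ(n-1) = n)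
-- such that σ C_q has exactly n - 2g cycles (written cycles + 2g = n).
-- (σ C_q)(x) = σ(C_q(x)).
N : ℕ → ℕ → ℕ → ℕ
N n q g = length (filter (λ w → T? (good w)) (words n n))
  where
  good : List ℕ → Bool
  good w = isPerm n w
         ∧ isNCycle n (apply w)
         ∧ (apply w (n ∸ 1) ≡ᵇ n)
         ∧ (cycleCount n (λ x → apply w (Cq n q x)) + 2 * g ≡ᵇ n)

{-# OPTIONS --safe #-}
module Submission where

-- Write a = q − 1 and b = n − q. An n-cycle σ with σ(n−1) = n is s ∘ (n−1, n)
-- with s an (n−1)-cycle fixing n, and (n−1, n) C_q = (n, 1, …, a)(a+1, …, n−1).
-- Deleting the point n, which s fixes, leaves the number of cycles of σ C_q
-- unchanged, so it is that of s ∘ (1, …, a)(a+1, …, n−1), with s now an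
-- arbitrary (n−1)-cycle of [n−1]. Replacing q by n + 1 − q exchanges a and b,
-- and conjugation by the rotation exchanging the two blocks identifies the two
-- counts.

open import Defs
open import Data.Nat using (ℕ; zero; suc; _+_; _*_; _∸_; _⊓_; _≤_; _<_; _≤ᵇ_; _≡ᵇ_; _≤?_; _≟_; z≤n; s≤s; s≤s⁻¹)
open import Data.Nat.Properties
open import Data.Bool using (Bool; true; false; T; _∧_; if_then_else_)
open import Data.Bool.ListAction using (all; any)
open import Data.Bool.Properties using (T?)
open import Data.Empty using (⊥-elim)
open import Data.Fin using (toℕ; fromℕ<)
open import Data.Fin.Properties using (pigeonhole; toℕ<n; fromℕ<-injective)
open import Data.List using (List; []; _∷_; _++_; map; concatMap; filter; length; upTo; applyUpTo; cartesianProductWith)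
open import Data.List.Properties using (map-upTo; length-applyUpTo; ∷-injective; length-++; ++-assoc)
open import Data.List.Membership.Propositional using (_∈_)
open import Data.List.Membership.Propositional.Properties using (∈-map⁺; ∈-map⁻; ∈-upTo⁺; ∈-upTo⁻; ∈-∃++; ∈-++⁺ˡ; ∈-++⁺ʳ; ∈-++⁻; ∈-filter⁺; ∈-filter⁻; ∈-cartesianProductWith⁺; ∈-cartesianProductWith⁻)
open import Data.List.Relation.Unary.All using (All; []; _∷_; tabulate; lookup)
import Data.List.Relation.Unary.All.Properties as All
open import Data.List.Relation.Unary.Any using (here; there)
import Data.List.Relation.Unary.Any.Properties as Any
open import Data.List.Relation.Unary.AllPairs using ([]; _∷_)
open import Data.List.Relation.Unary.Unique.Propositional using (Unique)
import Data.List.Relation.Unary.Unique.Propositional.Properties as Unique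
open import Data.Product using (∃; _×_; _,_; proj₁; proj₂)
open import Data.Sum using (_⊎_; inj₁; inj₂)
open import Function using (_∘_; id)
open import Relation.Binary.Definitions using (tri<; tri≈; tri>)
open import Relation.Binary.PropositionalEquality using (_≡_; _≢_; refl; sym; trans; cong; cong₂; subst; subst₂)
open import Relation.Nullary using (Dec; yes; no; contradiction)
open import Relation.Unary using (Decidable)

-- Finite lists

-- The point n is never actually deleted: all permutations stay on [n], and there the block rotation
-- does not conjugate one product to the other. In (n, 1, ..., a)(a+1, ..., n-1) the root n follows
-- a, and in the same product for b it follows b; but `rot a b` carries a to n-1 and n-1 to b, so
-- the root has to leave the image of the first block and enter the image of the second. Conjugacy
-- is therefore weakened to `OrbitCover`, where one step of a permutation may become any number of
-- steps of the other. A step onto the root may collapse and another may become a detour through it.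
-- This is harmless because s fixes n, so that the root merely subdivides an orbit. One direction is
-- enough throughout: a cover bounds one cycle count by another, an injection of words bounds one
-- value of `N` by another, and each opposite inequality is the same statement with a and b
-- exchanged.

module _ {A B : Set} (h : A → B) where

  -- Induction deleting one occurrence of `h x` from `ys`. A later image equal to the deleted entry
  -- would, by injectivity, make `x` recur in `xs`.
  length-injection : ∀ xs ys → Unique xs → (∀ {x} → x ∈ xs → h x ∈ ys) →
    (∀ {x y} → x ∈ xs → y ∈ xs → h x ≡ h y → x ≡ y) → length xs ≤ length ys
  length-injection []       ys _           into inj = z≤n
  length-injection (x ∷ xs) ys (x∉xs ∷ uq) into inj with ∈-∃++ (into (here refl))
  ... | l , r , refl = subst (suc (length xs) ≤_) (sym length-split)
      (s≤s (length-injection xs (l ++ r) uq into′ (λ p q → inj (there p) (there q))))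
    where
    length-split : length (l ++ h x ∷ r) ≡ suc (length (l ++ r))
    length-split = trans (length-++ l) (trans (+-suc _ _) (cong suc (sym (length-++ l))))

    into′ : ∀ {y} → y ∈ xs → h y ∈ l ++ r
    into′ y∈ with ∈-++⁻ l (into (there y∈))
    ... | inj₁ p           = ∈-++⁺ˡ p
    ... | inj₂ (there p)   = ∈-++⁺ʳ l p
    ... | inj₂ (here hy≡hx) = contradiction (inj (here refl) (there y∈) (sym hy≡hx)) (lookup x∉xs y∈)

  -- The counting tool for both levels of the proof: cycles, represented by their least elements,
  -- and words.
  length-filter-injection : {P : A → Set} {Q : B → Set} (P? : Decidable P) (Q? : Decidable Q) →
    ∀ {xs ys} → Unique xs → (∀ {x} → x ∈ xs → P x → h x ∈ ys × Q (h x)) →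
    (∀ {x y} → x ∈ xs → P x → y ∈ xs → P y → h x ≡ h y → x ≡ y) →
    length (filter P? xs) ≤ length (filter Q? ys)
  length-filter-injection P? Q? uq into inj =
    length-injection _ _ (Unique.filter⁺ P? uq)
      (λ x∈ → let x∈xs , Px = ∈-filter⁻ P? x∈ ; hx∈ , Qhx = into x∈xs Px in ∈-filter⁺ Q? hx∈ Qhx)
      (λ x∈ y∈ → let x∈xs , Px = ∈-filter⁻ P? x∈ ; y∈xs , Py = ∈-filter⁻ P? y∈ in inj x∈xs Px y∈xs Py)

all-∈ : {A : Set} (p : A → Bool) {xs : List A} → T (all p xs) → ∀ {x} → x ∈ xs → T (p x)
all-∈ p {xs} t = lookup (All.all⁺ p xs t)

∈-all : {A : Set} (p : A → Bool) {xs : List A} → (∀ {x} → x ∈ xs → T (p x)) → T (all p xs)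
∈-all p f = All.all⁻ p (tabulate f)

-- The set [n] and words over it

infix 4 _∈[_]
_∈[_] : ℕ → ℕ → Set
x ∈[ n ] = 1 ≤ x × x ≤ n

∈-labels⁺ : ∀ {n x} → x ∈[ n ] → x ∈ labels n
∈-labels⁺ {x = suc x} (_ , x<n) = ∈-map⁺ suc (∈-upTo⁺ x<n)

∈-labels⁻ : ∀ {n x} → x ∈ labels n → x ∈[ n ]
∈-labels⁻ x∈ with ∈-map⁻ suc x∈
... | _ , y∈ , refl = s≤s z≤n , ∈-upTo⁻ y∈

labels-unique : ∀ n → Unique (labels n)
labels-unique n = Unique.map⁺ suc-injective (Unique.upTo⁺ n)

words-cartesian : ∀ n k → words n (suc k) ≡ cartesianProductWith _∷_ (labels n) (words n k)
words-cartesian n k = concatMap-cartesian (labels n)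
  where
  concatMap-cartesian : ∀ xs →
    concatMap (λ x → map (x ∷_) (words n k)) xs ≡ cartesianProductWith _∷_ xs (words n k)
  concatMap-cartesian []       = refl
  concatMap-cartesian (x ∷ xs) = cong (map (x ∷_) (words n k) ++_) (concatMap-cartesian xs)

words-unique : ∀ n k → Unique (words n k)
words-unique n zero    = [] ∷ []
words-unique n (suc k) rewrite words-cartesian n k =
  Unique.cartesianProductWith⁺ _∷_ ∷-injective (labels-unique n) (words-unique n k)

∈-words⁺ : ∀ {n w} → All (_∈[ n ]) w → w ∈ words n (length w)
∈-words⁺         []          = here refl
∈-words⁺ {n} {x ∷ w} (px ∷ pw) rewrite words-cartesian n (length w) =
  ∈-cartesianProductWith⁺ _∷_ (∈-labels⁺ px) (∈-words⁺ pw)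

∈-words⁻ : ∀ {n} k {w} → w ∈ words n k → length w ≡ k × All (_∈[ n ]) w
∈-words⁻ zero (here refl) = refl , []
∈-words⁻ {n} (suc k) w∈ rewrite words-cartesian n k
  with ∈-cartesianProductWith⁻ _∷_ (labels n) (words n k) w∈
... | x , v , x∈ , v∈ , refl =
  let eq , pv = ∈-words⁻ k v∈ in cong suc eq , ∈-labels⁻ x∈ ∷ pv

apply-∈ : ∀ {P : ℕ → Set} {w} → All P w → ∀ {i} → i ∈[ length w ] → P (apply w i)
apply-∈ (px ∷ pw) {suc zero}    _             = px
apply-∈ (px ∷ pw) {suc (suc i)} (_ , s≤s i≤n) = apply-∈ pw (s≤s z≤n , i≤n)

apply-ext : ∀ v w → length v ≡ length w →
  (∀ {i} → i ∈[ length v ] → apply v i ≡ apply w i) → v ≡ w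
apply-ext []      []      _  _  = refl
apply-ext (x ∷ v) (y ∷ w) eq pt = cong₂ _∷_ (pt (s≤s z≤n , s≤s z≤n)) (apply-ext v w (suc-injective eq) tail-eq)
  where
  tail-eq : ∀ {i} → i ∈[ length v ] → apply v i ≡ apply w i
  tail-eq {suc i} (_ , i≤) = pt {suc (suc i)} (s≤s z≤n , s≤s i≤)

tabulateWord : ℕ → (ℕ → ℕ) → List ℕ
tabulateWord n f = applyUpTo (f ∘ suc) n

apply-tabulateWord : ∀ n f {i} → i ∈[ n ] → apply (tabulateWord n f) i ≡ f i
apply-tabulateWord (suc n) f {suc zero}    _            = refl
apply-tabulateWord (suc n) f {suc (suc i)} (_ , s≤s i≤) = apply-tabulateWord n (f ∘ suc) (s≤s z≤n , i≤)

tabulateWord-∈-words : ∀ n {f} → (∀ {x} → x ∈[ n ] → f x ∈[ n ]) → tabulateWord n f ∈ words n n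
tabulateWord-∈-words n {f} maps = subst (λ k → tabulateWord n f ∈ words n k) (length-applyUpTo _ n)
  (∈-words⁺ (All.applyUpTo⁺₁ _ n (λ i<n → maps (s≤s z≤n , i<n))))

-- Permutations of [n] and their orbits

-- The functions are total on ℕ, but only their behaviour on [n] is controlled. Finiteness of [n]
-- enters through `period`, by which every point returns to itself.
record PermOn (n : ℕ) (f : ℕ → ℕ) : Set where
  field
    maps : ∀ {x} → x ∈[ n ] → f x ∈[ n ]
    inj  : ∀ {x y} → x ∈[ n ] → y ∈[ n ] → f x ≡ f y → x ≡ y

open PermOn

∘-permOn : ∀ {n f g} → PermOn n f → PermOn n g → PermOn n (f ∘ g)
∘-permOn F G .maps x∈        = maps F (maps G x∈)
∘-permOn F G .inj x∈ y∈ eq = inj G x∈ y∈ (inj F (maps G x∈) (maps G y∈) eq)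

permOn-resp : ∀ {n f g} → (∀ {x} → x ∈[ n ] → g x ≡ f x) → PermOn n f → PermOn n g
permOn-resp     g≗f F .maps x∈       = subst (_∈[ _ ]) (sym (g≗f x∈)) (maps F x∈)
permOn-resp     g≗f F .inj x∈ y∈ eq = inj F x∈ y∈ (trans (sym (g≗f x∈)) (trans eq (g≗f y∈)))

inverse-permOn : ∀ {n f g} → (∀ {x} → x ∈[ n ] → f x ∈[ n ]) → (∀ {x} → x ∈[ n ] → g (f x) ≡ x) → PermOn n f
inverse-permOn         into g∘f .maps         = into
inverse-permOn {g = g} into g∘f .inj x∈ y∈ eq = trans (sym (g∘f x∈)) (trans (cong g eq) (g∘f y∈))

infix 4 _⊢_↝_
-- Without a bound on the number of steps, paths compose freely; `↝-bounded` restores the bound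
-- `k < n` built into `cycleCount` and `isNCycle`.
_⊢_↝_ : (ℕ → ℕ) → ℕ → ℕ → Set
f ⊢ x ↝ y = ∃ λ k → iter f k x ≡ y

iter-+ : ∀ f j k x → iter f (j + k) x ≡ iter f j (iter f k x)
iter-+ f zero    k x = refl
iter-+ f (suc j) k x = cong f (iter-+ f j k x)

↝-refl : ∀ {f x} → f ⊢ x ↝ x
↝-refl = 0 , refl

↝-reflexive : ∀ {f x y} → x ≡ y → f ⊢ x ↝ y
↝-reflexive eq = 0 , eq

↝-step : ∀ {f x y} → f x ≡ y → f ⊢ x ↝ y
↝-step eq = 1 , eq

↝-trans : ∀ {f x y z} → f ⊢ x ↝ y → f ⊢ y ↝ z → f ⊢ x ↝ z
↝-trans {f} {x} (j , refl) (k , refl) = k + j , iter-+ f k j x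

module _ {n f} (F : PermOn n f) where

  iter-∈ : ∀ k {x} → x ∈[ n ] → iter f k x ∈[ n ]
  iter-∈ zero    x∈ = x∈
  iter-∈ (suc k) x∈ = maps F (iter-∈ k x∈)

  ↝-∈ : ∀ {x y} → x ∈[ n ] → f ⊢ x ↝ y → y ∈[ n ]
  ↝-∈ x∈ (k , refl) = iter-∈ k x∈

  iter-inj : ∀ k {x y} → x ∈[ n ] → y ∈[ n ] → iter f k x ≡ iter f k y → x ≡ y
  iter-inj zero    x∈ y∈ eq = eq
  iter-inj (suc k) x∈ y∈ eq = iter-inj k x∈ y∈ (inj F (iter-∈ k x∈) (iter-∈ k y∈) eq)

  -- Among the iterates 0, ..., n two coincide by the pigeonhole principle, and injectivity cancels
  -- the common initial steps. The form `suc t` makes the period positive.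
  period : ∀ {x} → x ∈[ n ] → ∃ λ t → t < n × iter f (suc t) x ≡ x
  period {x} x∈ = t , t<n , sym (iter-inj i x∈ (iter-∈ (suc t) x∈) (trans eq (trans (cong (λ k → iter f k x) j≡) (iter-+ f i (suc t) x))))
    where
    pred< : ∀ {y} → y ∈[ n ] → y ∸ 1 < n
    pred< {suc y} (_ , y<n) = y<n

    pred-inj : ∀ {y z} → y ∈[ n ] → z ∈[ n ] → y ∸ 1 ≡ z ∸ 1 → y ≡ z
    pred-inj {suc y} {suc z} _ _ eq = cong suc eq

    collision : ∃ λ i → ∃ λ j → i < j × j ≤ n × iter f i x ≡ iter f j x
    collision with pigeonhole (n<1+n n) (λ i → fromℕ< (pred< (iter-∈ (toℕ i) x∈)))
    ... | i , j , i<j , eq = toℕ i , toℕ j , i<j , s≤s⁻¹ (toℕ<n j) ,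
      pred-inj (iter-∈ (toℕ i) x∈) (iter-∈ (toℕ j) x∈) (fromℕ<-injective _ _ _ _ eq)

    i = proj₁ collision
    j = proj₁ (proj₂ collision)
    i<j = proj₁ (proj₂ (proj₂ collision))
    j≤n = proj₁ (proj₂ (proj₂ (proj₂ collision)))
    eq = proj₂ (proj₂ (proj₂ (proj₂ collision)))
    t = j ∸ suc i

    j≡ : j ≡ i + suc t
    j≡ = sym (trans (+-suc i t) (m+[n∸m]≡n i<j))

    t<n : t < n
    t<n = ≤-trans (m≤n+m (suc t) i) (subst (_≤ n) j≡ j≤n)

  -- `r` is the remainder of `k` modulo `suc t`, computed by counting up and returning to 0 after
  -- `t`.
  iter-mod-period : ∀ {t x} → iter f (suc t) x ≡ x → ∀ k → ∃ λ r → r ≤ t × iter f r x ≡ iter f k x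
  iter-mod-period         per zero    = 0 , z≤n , refl
  iter-mod-period {t} per (suc k) with iter-mod-period per k
  ... | r , r≤t , eq with r ≟ t
  ...   | yes refl = 0 , z≤n , trans (sym per) (cong f eq)
  ...   | no  r≢t  = suc r , ≤∧≢⇒< r≤t r≢t , cong f eq

  ↝-bounded : ∀ {x y} → x ∈[ n ] → f ⊢ x ↝ y → ∃ λ k → k < n × iter f k x ≡ y
  ↝-bounded x∈ (k , refl) =
    let t , t<n , per = period x∈ ; r , r≤t , eq = iter-mod-period per k in r , ≤-<-trans r≤t t<n , eq

  ↝-sym : ∀ {x y} → x ∈[ n ] → f ⊢ x ↝ y → f ⊢ y ↝ x
  ↝-sym {x} x∈ (k , refl) with period x∈
  ... | t , _ , per with iter-mod-period per k
  -- What remains of a full turn after `r` steps.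
  ...   | r , r≤t , eq = suc t ∸ r ,
    trans (cong (iter f (suc t ∸ r)) (sym eq))
      (trans (sym (iter-+ f (suc t ∸ r) r x))
        (trans (cong (λ k → iter f k x) (m∸n+n≡m (m≤n⇒m≤1+n r≤t))) per))

-- Least elements of orbits and the comparison of cycle counts

IsMinOfOrbit : ℕ → (ℕ → ℕ) → ℕ → Set
IsMinOfOrbit n f i = T (all (λ k → i ≤ᵇ iter f k i) (upTo n))

module _ {n f} (F : PermOn n f) where

  isMinOfOrbit⁺ : ∀ {i} → (∀ {j} → f ⊢ i ↝ j → i ≤ j) → IsMinOfOrbit n f i
  isMinOfOrbit⁺ {i} least = ∈-all (λ k → i ≤ᵇ iter f k i) {upTo n} (λ {k} _ → ≤⇒≤ᵇ (least (k , refl)))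

  isMinOfOrbit⁻ : ∀ {i j} → i ∈[ n ] → IsMinOfOrbit n f i → f ⊢ i ↝ j → i ≤ j
  isMinOfOrbit⁻ {i} i∈ min i↝j with ↝-bounded F i∈ i↝j
  ... | k , k<n , refl = ≤ᵇ⇒≤ i _ (all-∈ (λ k → i ≤ᵇ iter f k i) min (∈-upTo⁺ k<n))

  isMinOfOrbit-unique : ∀ {i j} → i ∈[ n ] → j ∈[ n ] → IsMinOfOrbit n f i → IsMinOfOrbit n f j →
    f ⊢ i ↝ j → i ≡ j
  isMinOfOrbit-unique i∈ j∈ mini minj i↝j =
    ≤-antisym (isMinOfOrbit⁻ i∈ mini i↝j) (isMinOfOrbit⁻ j∈ minj (↝-sym F i∈ i↝j))

  -- At `k = n` the minimum runs over the whole orbit, by `↝-bounded`.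
  orbitMin : ℕ → ℕ → ℕ
  orbitMin zero    x = x
  orbitMin (suc k) x = iter f k x ⊓ orbitMin k x

  orbitMin-↝ : ∀ k x → f ⊢ x ↝ orbitMin k x
  orbitMin-↝ zero    x = ↝-refl
  orbitMin-↝ (suc k) x with ⊓-sel (iter f k x) (orbitMin k x)
  ... | inj₁ eq = k , sym eq
  ... | inj₂ eq = subst (f ⊢ x ↝_) (sym eq) (orbitMin-↝ k x)

  orbitMin-≤ : ∀ {j} k x → j < k → orbitMin k x ≤ iter f j x
  orbitMin-≤ {j} (suc k) x (s≤s j≤k) with j ≟ k
  ... | yes refl = m⊓n≤m _ _
  ... | no  j≢k  = ≤-trans (m⊓n≤n (iter f k x) _) (orbitMin-≤ k x (≤∧≢⇒< j≤k j≢k))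

  orbitMin-isMin : ∀ {x} → x ∈[ n ] → IsMinOfOrbit n f (orbitMin n x)
  orbitMin-isMin {x} x∈ = isMinOfOrbit⁺ λ min↝j →
    let k , k<n , eq = ↝-bounded F x∈ (↝-trans (orbitMin-↝ n x) min↝j)
    in subst (orbitMin n x ≤_) eq (orbitMin-≤ n x k<n)

-- Such a φ induces a surjection from the orbits of f onto those of h.
record OrbitCover (n : ℕ) (f h φ ψ : ℕ → ℕ) : Set where
  field
    φ-∈    : ∀ {x} → x ∈[ n ] → φ x ∈[ n ]
    φ-step : ∀ {x} → x ∈[ n ] → h ⊢ φ x ↝ φ (f x)
    ψ-∈    : ∀ {y} → y ∈[ n ] → ψ y ∈[ n ]
    φ-ψ    : ∀ {y} → y ∈[ n ] → h ⊢ φ (ψ y) ↝ y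

module _ {n f h φ ψ} (F : PermOn n f) (H : PermOn n h) (cover : OrbitCover n f h φ ψ) where
  open OrbitCover cover

  φ-↝ : ∀ {x y} → x ∈[ n ] → f ⊢ x ↝ y → h ⊢ φ x ↝ φ y
  φ-↝ x∈ (zero  , refl) = ↝-refl
  φ-↝ x∈ (suc k , refl) = ↝-trans (φ-↝ x∈ (k , refl)) (φ-step (iter-∈ F k x∈))

  -- Go back from `y` to `φ (ψ y)`, follow the image of the path under `φ`, then go on from
  -- `φ (ψ z)` to `z`. Both uses of a cover, for cycle counts and for single orbits, rest on this.
  ψ-reflects-↝ : ∀ {y z} → y ∈[ n ] → z ∈[ n ] → f ⊢ ψ y ↝ ψ z → h ⊢ y ↝ z
  ψ-reflects-↝ y∈ z∈ ψy↝ψz =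
    ↝-trans (↝-sym H (φ-∈ (ψ-∈ y∈)) (φ-ψ y∈)) (↝-trans (φ-↝ (ψ-∈ y∈) ψy↝ψz) (φ-ψ z∈))

  -- A cover need not preserve least elements, so the least element `y` of an `h`-orbit is sent to
  -- the least element of the `f`-orbit of `ψ y`. Two that collide lie in one `h`-orbit and hence
  -- agree.
  cycleCount-cover : cycleCount n h ≤ cycleCount n f
  cycleCount-cover = length-filter-injection (orbitMin F n ∘ ψ) _ _ (labels-unique n)
    (λ y∈ _ → let ψy∈ = ψ-∈ (∈-labels⁻ y∈) in
      ∈-labels⁺ (↝-∈ F ψy∈ (orbitMin-↝ F n _)) , orbitMin-isMin F ψy∈)
    (λ {y} {z} y∈ miny z∈ minz eq →
      let y∈′ = ∈-labels⁻ y∈ ; z∈′ = ∈-labels⁻ z∈ in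
      isMinOfOrbit-unique H y∈′ z∈′ miny minz
        (ψ-reflects-↝ y∈′ z∈′ (↝-trans
          (subst (f ⊢ ψ y ↝_) eq (orbitMin-↝ F n (ψ y)))
          (↝-sym F (ψ-∈ z∈′) (orbitMin-↝ F n (ψ z))))))

-- Single orbits and the Boolean tests

SingleOrbit : ℕ → (ℕ → ℕ) → Set
SingleOrbit n f = ∀ {x} → x ∈[ n ] → f ⊢ n ↝ x

singleOrbit-cover : ∀ {n f h φ ψ} → PermOn n f → PermOn n h → OrbitCover n f h φ ψ →
  1 ≤ n → SingleOrbit n f → SingleOrbit n h
singleOrbit-cover {n} F H cover 1≤n single y∈ =
  ψ-reflects-↝ F H cover n∈ y∈ (↝-trans (↝-sym F n∈ (single (ψ-∈ n∈))) (single (ψ-∈ y∈)))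
  where
  open OrbitCover cover
  n∈ : n ∈[ n ]
  n∈ = 1≤n , ≤-refl

isNCycle⁻ : ∀ {n f} → T (isNCycle n f) → SingleOrbit n f
isNCycle⁻ {n} {f} t {x} x∈
  with Any.applyUpTo⁻ id (Any.any⁻ _ (upTo n) (all-∈ (λ j → any (λ k → iter f k n ≡ᵇ j) (upTo n)) t (∈-labels⁺ x∈)))
... | k , _ , eq = k , ≡ᵇ⇒≡ _ _ eq

isNCycle⁺ : ∀ {n f} → PermOn n f → 1 ≤ n → SingleOrbit n f → T (isNCycle n f)
isNCycle⁺ {n} {f} F 1≤n single = ∈-all (λ j → any (λ k → iter f k n ≡ᵇ j) (upTo n)) λ x∈ →
  let k , k<n , eq = ↝-bounded F (1≤n , ≤-refl) (single (∈-labels⁻ x∈))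
  in Any.any⁺ _ (Any.applyUpTo⁺ id (≡⇒≡ᵇ _ _ eq) k<n)

private
  T-if⁻ : ∀ {b c} → T (if b then c else true) → T b → T c
  T-if⁻ {true} t _ = t

  T-if⁺ : ∀ {b c} → (T b → T c) → T (if b then c else true)
  T-if⁺ {true}  f = f _
  T-if⁺ {false} f = _

isPerm⁻ : ∀ {n w} → w ∈ words n n → T (isPerm n w) → PermOn n (apply w)
isPerm⁻ {n} {w} w∈ t .maps x∈ =
  let eq , pw = ∈-words⁻ n w∈ in apply-∈ pw (subst (_ ∈[_]) (sym eq) x∈)
isPerm⁻ {n} {w} w∈ t .inj {x} {y} x∈ y∈ eq = ≡ᵇ⇒≡ _ _ (T-if⁻
  (all-∈ (λ j → if apply w x ≡ᵇ apply w j then x ≡ᵇ j else true)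
    (all-∈ (λ i → all (λ j → if apply w i ≡ᵇ apply w j then i ≡ᵇ j else true) (labels n)) t (∈-labels⁺ x∈))
    (∈-labels⁺ y∈))
  (≡⇒≡ᵇ _ _ eq))

isPerm⁺ : ∀ {n w} → PermOn n (apply w) → T (isPerm n w)
isPerm⁺ {n} {w} W = ∈-all _ λ {i} i∈ → ∈-all _ λ {j} j∈ → T-if⁺ λ t →
  ≡⇒≡ᵇ i j (inj W (∈-labels⁻ i∈) (∈-labels⁻ j∈) (≡ᵇ⇒≡ (apply w i) (apply w j) t))

-- The transposition (m, m+1) and the block rotation

abstract
  swap : ℕ → ℕ → ℕ
  swap m x with x ≟ m | x ≟ suc m
  ... | yes _ | _     = suc m
  ... | no  _ | yes _ = m
  ... | no  _ | no  _ = x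

  swap-m : ∀ m → swap m m ≡ suc m
  swap-m m with m ≟ m | m ≟ suc m
  ... | yes _  | _ = refl
  ... | no m≢m | _ = contradiction refl m≢m

  swap-suc : ∀ m → swap m (suc m) ≡ m
  swap-suc m with suc m ≟ m | suc m ≟ suc m
  ... | yes eq | _      = contradiction eq 1+n≢n
  ... | no _   | yes _  = refl
  ... | no _   | no neq = contradiction refl neq

  swap-other : ∀ {m x} → x ≢ m → x ≢ suc m → swap m x ≡ x
  swap-other {m} {x} x≢m x≢n with x ≟ m | x ≟ suc m
  ... | yes eq | _      = contradiction eq x≢m
  ... | no _   | yes eq = contradiction eq x≢n
  ... | no _   | no _   = refl

swap-< : ∀ {m x} → x < m → swap m x ≡ x
swap-< x<m = swap-other (<⇒≢ x<m) (<⇒≢ (m<n⇒m<1+n x<m))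

data Trichotomy (m : ℕ) : ℕ → Set where
  below : ∀ {x} → 1 ≤ x → x < m → Trichotomy m x
  at    : Trichotomy m m
  above : Trichotomy m (suc m)

trichotomy : ∀ {m x} → x ∈[ suc m ] → Trichotomy m x
trichotomy {m} {x} (1≤x , x≤n) with x ≟ m | x ≟ suc m
... | yes refl | _        = at
... | no _     | yes refl = above
... | no x≢m   | no x≢n   = below 1≤x (≤∧≢⇒< (s≤s⁻¹ (≤∧≢⇒< x≤n x≢n)) x≢m)

swap-involutive : ∀ m x → swap m (swap m x) ≡ x
swap-involutive m x = by-cases (x ≟ m) (x ≟ suc m)
  where
  by-cases : Dec (x ≡ m) → Dec (x ≡ suc m) → swap m (swap m x) ≡ x
  by-cases (yes refl) _          = trans (cong (swap m) (swap-m m)) (swap-suc m)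
  by-cases (no _)     (yes refl) = trans (cong (swap m) (swap-suc m)) (swap-m m)
  by-cases (no x≢m)   (no x≢n)   = trans (cong (swap m) (swap-other x≢m x≢n)) (swap-other x≢m x≢n)

swap-∈ : ∀ {m x} → 1 ≤ m → x ∈[ suc m ] → swap m x ∈[ suc m ]
swap-∈ {m} 1≤m x∈ with trichotomy x∈
... | below _ x<m = subst (_∈[ suc m ]) (sym (swap-< x<m)) x∈
... | at          = subst (_∈[ suc m ]) (sym (swap-m m)) (s≤s z≤n , ≤-refl)
... | above       = subst (_∈[ suc m ]) (sym (swap-suc m)) (1≤m , n≤1+n m)

swap-permOn : ∀ {m} → 1 ≤ m → PermOn (suc m) (swap m)
swap-permOn 1≤m = inverse-permOn {g = swap _} (swap-∈ 1≤m) (λ {x} _ → swap-involutive _ x)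

abstract
  -- The translation by b modulo a + b on the representatives 1, ..., a + b, continued by the
  -- identity above them. Its inverse is `rot b a`.
  rot : ℕ → ℕ → ℕ → ℕ
  rot a b x with x ≤? a | x ≤? a + b
  ... | yes _ | _     = b + x
  ... | no  _ | yes _ = x ∸ a
  ... | no  _ | no _  = x

  rot-low : ∀ a b {x} → x ≤ a → rot a b x ≡ b + x
  rot-low a b {x} x≤a with x ≤? a | x ≤? a + b
  ... | yes _  | _ = refl
  ... | no x≰a | _ = contradiction x≤a x≰a

  rot-high : ∀ a b {k} → 1 ≤ k → k ≤ b → rot a b (a + k) ≡ k
  rot-high a b {k} 1≤k k≤b with a + k ≤? a | a + k ≤? a + b
  ... | yes p | _     = contradiction p (<⇒≱ (m<m+n a 1≤k))
  ... | no _  | yes _ = m+n∸m≡n a k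
  ... | no _  | no p  = contradiction (+-monoʳ-≤ a k≤b) p

  rot-above : ∀ a b {x} → a + b < x → rot a b x ≡ x
  rot-above a b {x} lt with x ≤? a | x ≤? a + b
  ... | yes p | _     = contradiction (≤-trans p (m≤m+n a b)) (<⇒≱ lt)
  ... | no _  | yes p = contradiction p (<⇒≱ lt)
  ... | no _  | no _  = refl

data Blocks (a b : ℕ) : ℕ → Set where
  low  : ∀ {x} → 1 ≤ x → x ≤ a → Blocks a b x
  high : ∀ {k} → 1 ≤ k → k ≤ b → Blocks a b (a + k)

blocks : ∀ a b {x} → x ∈[ a + b ] → Blocks a b x
blocks a b {x} (1≤x , x≤m) with x ≤? a
... | yes x≤a = low 1≤x x≤a
... | no  x≰a = subst (Blocks a b) (m+[n∸m]≡n (≰⇒≥ x≰a))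
  (high (m<n⇒0<n∸m (≰⇒> x≰a)) (subst (x ∸ a ≤_) (m+n∸m≡n a b) (∸-monoˡ-≤ a x≤m)))

rot-∈ : ∀ a b {x} → x ∈[ a + b ] → rot a b x ∈[ a + b ]
rot-∈ a b x∈ with blocks a b x∈
... | low {x} 1≤x x≤a = subst (_∈[ a + b ]) (sym (rot-low a b x≤a))
  (≤-trans 1≤x (m≤n+m x b) , subst (b + x ≤_) (+-comm b a) (+-monoʳ-≤ b x≤a))
... | high 1≤k k≤b = subst (_∈[ a + b ]) (sym (rot-high a b 1≤k k≤b)) (1≤k , ≤-trans k≤b (m≤n+m b a))

-- The point 0 is excluded since `rot a b` sends it to b, which for positive b returns as a + b.
rot-inverse : ∀ a b {x} → 1 ≤ x → rot b a (rot a b x) ≡ x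
rot-inverse a b {x} 1≤x with ≤-<-connex x (a + b)
... | inj₂ m<x = trans (cong (rot b a) (rot-above a b m<x)) (rot-above b a (subst (_< x) (+-comm a b) m<x))
... | inj₁ x≤m with blocks a b (1≤x , x≤m)
...   | low 1≤x x≤a  = trans (cong (rot b a) (rot-low a b x≤a)) (rot-high b a 1≤x x≤a)
...   | high 1≤k k≤b = trans (cong (rot b a) (rot-high a b 1≤k k≤b)) (rot-low b a k≤b)

-- The cycle C_q

-- Successor along an open word. A cycle becomes such a word by repeating its first letter at the
-- end, and the word can then be cut into consecutive pieces.
walk : ℕ → List ℕ → ℕ
walk x []          = x
walk x (u ∷ [])    = x
walk x (u ∷ v ∷ l) = if u ≡ᵇ x then v else walk x (v ∷ l)

walkCyclically : ℕ → ℕ → List ℕ → ℕ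
walkCyclically c x []          = x
walkCyclically c x (u ∷ [])    = if u ≡ᵇ x then c else x
walkCyclically c x (u ∷ v ∷ l) = if u ≡ᵇ x then v else walkCyclically c x (v ∷ l)

walkCyclically≡walk : ∀ c x l → walkCyclically c x l ≡ walk x (l ++ c ∷ [])
walkCyclically≡walk c x []          = refl
walkCyclically≡walk c x (u ∷ [])    = refl
walkCyclically≡walk c x (u ∷ v ∷ l) = cong (if u ≡ᵇ x then v else_) (walkCyclically≡walk c x (v ∷ l))

-- The auxiliary function of cyclePerm cannot be named, so the left-hand side
-- of the first statement is left for the second one to determine.
mutual
  cyclePerm-go≡walkCyclically : ∀ c cs x l → _ ≡ walkCyclically c x l
  cyclePerm-go≡walkCyclically c cs x []          = refl
  cyclePerm-go≡walkCyclically c cs x (u ∷ [])    = refl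
  cyclePerm-go≡walkCyclically c cs x (u ∷ v ∷ l) =
    cong (if u ≡ᵇ x then v else_) (cyclePerm-go≡walkCyclically c cs x (v ∷ l))

  cyclePerm≡walkCyclically : ∀ c cs x → cyclePerm (c ∷ cs) x ≡ walkCyclically c x (c ∷ cs)
  -- Only the traversed list becomes a variable; `c` and `cs` stay as parameters. The omitted side
  -- is then constrained by a term in distinct variables, which determines it.
  cyclePerm≡walkCyclically c cs x with c ∷ cs
  ... | l = cyclePerm-go≡walkCyclically c cs x l

cyclePerm≡walk : ∀ c cs x → cyclePerm (c ∷ cs) x ≡ walk x (c ∷ cs ++ c ∷ [])
cyclePerm≡walk c cs x = trans (cyclePerm≡walkCyclically c cs x) (walkCyclically≡walk c x (c ∷ cs))

walk-hit : ∀ x v l → walk x (x ∷ v ∷ l) ≡ v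
walk-hit x v l with x ≡ᵇ x in eq
... | true  = refl
... | false = ⊥-elim (subst T eq (≡⇒≡ᵇ x x refl))

walk-skip : ∀ {x u} l → u ≢ x → walk x (u ∷ l) ≡ walk x l
walk-skip []      u≢x = refl
walk-skip {x} {u} (v ∷ l) u≢x with u ≡ᵇ x in eq
... | true  = contradiction (≡ᵇ⇒≡ u x (subst T (sym eq) _)) u≢x
... | false = refl

-- Successors along intervals

segment : ℕ → ℕ → List ℕ
segment s zero    = []
segment s (suc k) = s ∷ segment (suc s) k

map-+-upTo : ∀ s k → map (s +_) (upTo k) ≡ segment s k
map-+-upTo s k = trans (map-upTo (s +_) k) (applyUpTo-segment s k (λ _ → refl))
  where
  applyUpTo-segment : ∀ {f} s k → (∀ i → f i ≡ s + i) → applyUpTo f k ≡ segment s k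
  applyUpTo-segment s zero    eq = refl
  applyUpTo-segment s (suc k) eq = cong₂ _∷_ (trans (eq 0) (+-identityʳ s))
    (applyUpTo-segment (suc s) k (λ i → trans (eq (suc i)) (+-suc s i)))

walk-segment-outside : ∀ {x} s k l → x < s ⊎ s + k ≤ x → walk x (segment s k ++ l) ≡ walk x l
walk-segment-outside s zero    l _   = refl
walk-segment-outside {x} s (suc k) l out =
  trans (walk-skip (segment (suc s) k ++ l) (s≢x out)) (walk-segment-outside (suc s) k l (next out))
  where
  s≢x : x < s ⊎ s + suc k ≤ x → s ≢ x
  s≢x (inj₁ x<s) refl = <-irrefl refl x<s
  s≢x (inj₂ le)  refl = <⇒≱ (m<m+n s (s≤s z≤n)) le

  next : x < s ⊎ s + suc k ≤ x → x < suc s ⊎ suc s + k ≤ x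
  next (inj₁ x<s) = inj₁ (m<n⇒m<1+n x<s)
  next (inj₂ le)  = inj₂ (subst (_≤ x) (+-suc s k) le)

walk-segment-inside : ∀ {x} s k l → s ≤ x → suc x < s + k → walk x (segment s k ++ l) ≡ suc x
walk-segment-inside {x} s zero l s≤x lt =
  contradiction (subst (suc x <_) (+-identityʳ s) lt) (≤⇒≯ (m≤n⇒m≤1+n s≤x))
walk-segment-inside {x} s (suc k) l s≤x lt with s ≟ x
walk-segment-inside s (suc zero) l s≤x lt | yes refl =
  contradiction (subst (suc s <_) (+-comm s 1) lt) (<-irrefl refl)
walk-segment-inside s (suc (suc k)) l s≤x lt | yes refl = walk-hit s (suc s) (segment (2 + s) k ++ l)
... | no s≢x = trans (walk-skip (segment (suc s) k ++ l) s≢x)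
  (walk-segment-inside (suc s) k l (≤∧≢⇒< s≤x s≢x) (subst (suc x <_) (+-suc s k) lt))

walk-segment-last : ∀ {x} s k z l → s ≤ x → suc x ≡ s + k → walk x (segment s k ++ z ∷ l) ≡ z
walk-segment-last {x} s zero z l s≤x eq =
  contradiction s≤x (<⇒≱ (≤-reflexive (trans eq (+-identityʳ s))))
walk-segment-last {x} s (suc k) z l s≤x eq with s ≟ x
walk-segment-last s (suc zero) z l s≤x eq | yes refl = walk-hit s z l
walk-segment-last s (suc (suc k)) z l s≤x eq | yes refl =
  contradiction (trans eq (trans (+-suc s (suc k)) (cong suc (+-suc s k)))) (<⇒≢ (s≤s (s≤s (m≤m+n s k))))
... | no s≢x = trans (walk-skip (segment (suc s) k ++ z ∷ l) s≢x)
  (walk-segment-last (suc s) k z l (≤∧≢⇒< s≤x s≢x) (trans eq (+-suc s k)))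

-- In cycle notation splitCycle m a = (m+1, 1, …, a)(a+1, …, m).
splitCycle : ℕ → ℕ → ℕ → ℕ
splitCycle m a x = swap m (Cq (suc m) (suc a) x)

module _ {m} a b (a+b≡m : a + b ≡ m) (1≤a : 1 ≤ a) (1≤b : 1 ≤ b) where

  private
    a<m : a < m
    a<m = subst (a <_) a+b≡m (m<m+n a 1≤b)

    -- The part of the closed cycle after m: the entries a+1, ..., m-1, which are b-1 in number, and
    -- the root once more.
    rest : List ℕ
    rest = segment (suc a) (b ∸ 1) ++ suc m ∷ []

    high-end : suc a + (b ∸ 1) ≡ m
    high-end = trans (sym (+-suc a (b ∸ 1))) (trans (cong (a +_) (m+[n∸m]≡n 1≤b)) a+b≡m)

    1<m : 1 < m
    1<m = ≤-<-trans 1≤a a<m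

  Cq≡walk : ∀ x → Cq (suc m) (suc a) x ≡ walk x (suc m ∷ segment 1 a ++ m ∷ rest)
  Cq≡walk x = trans (cyclePerm≡walk (suc m) (range 1 a ++ m ∷ range (suc a) (m ∸ 1)) x) (cong (λ l → walk x (suc m ∷ l)) (trans
      (++-assoc (range 1 a) (m ∷ range (suc a) (m ∸ 1)) (suc m ∷ []))
      (cong₂ (λ l r → l ++ m ∷ r ++ suc m ∷ []) (map-+-upTo 1 a) range-high)))
    where
    range-high : range (suc a) (m ∸ 1) ≡ segment (suc a) (b ∸ 1)
    range-high = trans (map-+-upTo (suc a) (m ∸ 1 ∸ a))
      (cong (segment (suc a)) (trans (cong (λ k → k ∸ 1 ∸ a) (sym high-end)) (m+n∸m≡n a (b ∸ 1))))

  Cq-skip-root : ∀ {x} → x ≤ m → Cq (suc m) (suc a) x ≡ walk x (segment 1 a ++ m ∷ rest)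
  Cq-skip-root {x} x≤m = trans (Cq≡walk x) (walk-skip (segment 1 a ++ m ∷ rest) (λ eq → <⇒≱ (s≤s x≤m) (≤-reflexive eq)))

  splitCycle-root : splitCycle m a (suc m) ≡ 1
  splitCycle-root = trans (cong (swap m) (trans (Cq≡walk (suc m)) (head≡1 1≤a))) (swap-< 1<m)
    where
    head≡1 : ∀ {a} {l : List ℕ} → 1 ≤ a → walk (suc m) (suc m ∷ segment 1 a ++ l) ≡ 1
    head≡1 {suc a} {l} _ = walk-hit (suc m) 1 (segment 2 a ++ l)

  -- In C_q the point a is followed by m. Exchanging the values m and m+1 makes the first block
  -- close up through the root, which cuts the cycle in two.
  splitCycle-a : splitCycle m a a ≡ suc m
  splitCycle-a = trans (cong (swap m) (trans (Cq-skip-root (<⇒≤ a<m)) (walk-segment-last 1 a m rest 1≤a refl)))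
    (swap-m m)

  splitCycle-m : splitCycle m a m ≡ suc a
  splitCycle-m = trans (cong (swap m) (trans (Cq-skip-root ≤-refl) (walk-segment-outside 1 a _ (inj₂ a<m))))
    (next (b ∸ 1) high-end)
    where
    next : ∀ k → suc a + k ≡ m → swap m (walk m (m ∷ segment (suc a) k ++ suc m ∷ [])) ≡ suc a
    -- For b = 1 the second block is the single point m = a + 1, fixed by `splitCycle`.
    next zero    eq = trans (cong (swap m) (walk-hit m (suc m) []))
      (trans (swap-suc m) (trans (sym eq) (+-identityʳ (suc a))))
    next (suc k) eq = trans (cong (swap m) (walk-hit m (suc a) (segment (2 + a) k ++ suc m ∷ [])))
      (swap-< (subst (suc a <_) eq (m<m+n (suc a) (s≤s z≤n))))

  splitCycle-low : ∀ {x} → 1 ≤ x → x < a → splitCycle m a x ≡ suc x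
  splitCycle-low 1≤x x<a = trans
    (cong (swap m) (trans (Cq-skip-root (<⇒≤ (<-trans x<a a<m))) (walk-segment-inside 1 a _ 1≤x (s≤s x<a))))
    (swap-< (≤-<-trans x<a a<m))

  splitCycle-high : ∀ {x} → a < x → x < m → splitCycle m a x ≡ suc x
  splitCycle-high {x} a<x x<m = trans (cong (swap m) skip) next
    where
    skip : Cq (suc m) (suc a) x ≡ walk x rest
    skip = trans (Cq-skip-root (<⇒≤ x<m)) (trans (walk-segment-outside 1 a _ (inj₂ a<x))
      (walk-skip rest (λ eq → <-irrefl (sym eq) x<m)))

    next : swap m (walk x rest) ≡ suc x
    next with suc x ≟ m
    -- The entry m-1 is followed by the root in C_q, and `swap` turns the root into m.
    ... | yes eq  = trans (cong (swap m) (walk-segment-last (suc a) (b ∸ 1) (suc m) [] a<x (trans eq (sym high-end))))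
      (trans (swap-suc m) (sym eq))
    ... | no  neq = trans (cong (swap m) (walk-segment-inside (suc a) (b ∸ 1) _ a<x
        (subst (suc x <_) (sym high-end) (≤∧≢⇒< x<m neq))))
      (swap-< (≤∧≢⇒< x<m neq))

  private
    -- A left inverse of `splitCycle m a` on [m+1]. The values 1, m+1 and a+1 come from m+1, a and
    -- m; every other value is the successor of its preimage.
    unsplit : ℕ → ℕ
    unsplit y with y ≟ 1 | y ≟ suc m | y ≟ suc a
    ... | yes _ | _     | _     = suc m
    ... | no _  | yes _ | _     = a
    ... | no _  | no _  | yes _ = m
    ... | no _  | no _  | no _  = y ∸ 1

    unsplit-1 : unsplit 1 ≡ suc m
    unsplit-1 = refl

    unsplit-root : unsplit (suc m) ≡ a
    unsplit-root with suc m ≟ 1 | suc m ≟ suc m | suc m ≟ suc a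
    ... | yes eq | _      | _ = contradiction (sym (suc-injective eq)) (<⇒≢ (<-trans (s≤s z≤n) 1<m))
    ... | no _   | yes _  | _ = refl
    ... | no _   | no neq | _ = contradiction refl neq

    unsplit-a : unsplit (suc a) ≡ m
    unsplit-a with suc a ≟ 1 | suc a ≟ suc m | suc a ≟ suc a
    ... | yes eq | _      | _      = contradiction (sym (suc-injective eq)) (<⇒≢ 1≤a)
    ... | no _   | yes eq | _      = contradiction (suc-injective eq) (<⇒≢ a<m)
    ... | no _   | no _   | yes _  = refl
    ... | no _   | no _   | no neq = contradiction refl neq

    unsplit-inner : ∀ {x} → 1 ≤ x → x < m → x ≢ a → unsplit (suc x) ≡ x
    unsplit-inner {x} 1≤x x<m x≢a with suc x ≟ 1 | suc x ≟ suc m | suc x ≟ suc a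
    ... | yes eq | _      | _      = contradiction (sym (suc-injective eq)) (<⇒≢ 1≤x)
    ... | no _   | yes eq | _      = contradiction (suc-injective eq) (<⇒≢ x<m)
    ... | no _   | no _   | yes eq = contradiction (suc-injective eq) x≢a
    ... | no _   | no _   | no _   = refl

    splitCycle-inner : ∀ {x} → 1 ≤ x → x < m → x ≢ a → splitCycle m a x ≡ suc x
    splitCycle-inner {x} 1≤x x<m x≢a with <-cmp x a
    ... | tri< x<a _ _ = splitCycle-low 1≤x x<a
    ... | tri≈ _ eq _  = contradiction eq x≢a
    ... | tri> _ _ a<x = splitCycle-high a<x x<m

    sends : ∀ {x y} → splitCycle m a x ≡ y → y ∈[ suc m ] → unsplit y ≡ x →
      splitCycle m a x ∈[ suc m ] × unsplit (splitCycle m a x) ≡ x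
    sends refl y∈ eq = y∈ , eq

    splitCycle-image : ∀ {x} → x ∈[ suc m ] →
      splitCycle m a x ∈[ suc m ] × unsplit (splitCycle m a x) ≡ x
    splitCycle-image x∈ with trichotomy x∈
    ... | above = sends splitCycle-root (s≤s z≤n , s≤s z≤n) unsplit-1
    ... | at    = sends splitCycle-m (s≤s z≤n , m≤n⇒m≤1+n a<m) unsplit-a
    ... | below {x} 1≤x x<m with x ≟ a
    ...   | yes refl = sends splitCycle-a (s≤s z≤n , ≤-refl) unsplit-root
    ...   | no x≢a   = sends (splitCycle-inner 1≤x x<m x≢a) (s≤s z≤n , m≤n⇒m≤1+n x<m) (unsplit-inner 1≤x x<m x≢a)

  -- C_q is recovered as `swap m` after `splitCycle m a`, since `swap m` is an involution.
  Cq-permOn : PermOn (suc m) (Cq (suc m) (suc a))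
  Cq-permOn = permOn-resp {f = swap m ∘ splitCycle m a} (λ _ → sym (swap-involutive m _))
    (∘-permOn (swap-permOn (<⇒≤ 1<m))
      (inverse-permOn {g = unsplit} (proj₁ ∘ splitCycle-image) (proj₂ ∘ splitCycle-image)))

-- The orbit covers

abstract
  -- The covers use the rotation on [m] and choose a separate value for the root, because the root
  -- is inserted at non-corresponding places on the two sides.
  extend : ℕ → (ℕ → ℕ) → ℕ → ℕ → ℕ
  extend m f v x with x ≟ suc m
  ... | yes _ = v
  ... | no  _ = f x

  extend-top : ∀ m f v → extend m f v (suc m) ≡ v
  extend-top m f v with suc m ≟ suc m
  ... | yes _  = refl
  ... | no neq = contradiction refl neq

  extend-≤ : ∀ {m x} f v → x ≤ m → extend m f v x ≡ f x
  extend-≤ {m} {x} f v x≤m with x ≟ suc m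
  ... | yes refl = contradiction x≤m 1+n≰n
  ... | no _     = refl

data TopView (m : ℕ) : ℕ → Set where
  under : ∀ {x} → x ∈[ m ] → TopView m x
  top   : TopView m (suc m)

topView : ∀ {m x} → x ∈[ suc m ] → TopView m x
topView {m} {x} (1≤x , x≤n) with x ≟ suc m
... | yes refl = top
... | no x≢n   = under (1≤x , s≤s⁻¹ (≤∧≢⇒< x≤n x≢n))

∈-weaken : ∀ {m x} → x ∈[ m ] → x ∈[ suc m ]
∈-weaken (1≤x , x≤m) = 1≤x , m≤n⇒m≤1+n x≤m

extend-∈ : ∀ {m f v x} → (∀ {x} → x ∈[ m ] → f x ∈[ m ]) → v ∈[ m ] → x ∈[ suc m ] →
  extend m f v x ∈[ suc m ]
extend-∈ {m} {f} {v} f-∈ v∈ x∈ with topView x∈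
... | under x∈′ = subst (_∈[ suc m ]) (sym (extend-≤ f v (proj₂ x∈′))) (∈-weaken (f-∈ x∈′))
... | top       = subst (_∈[ suc m ]) (sym (extend-top m f v)) (∈-weaken v∈)

fixes-top⇒maps : ∀ {m s} → PermOn (suc m) s → s (suc m) ≡ suc m → ∀ {x} → x ∈[ m ] → s x ∈[ m ]
fixes-top⇒maps {m} {s} S fix {x} x∈ = 1≤sx , s≤s⁻¹ (≤∧≢⇒< sx≤n sx≢n)
  where
  1≤sx = proj₁ (maps S (∈-weaken x∈))
  sx≤n = proj₂ (maps S (∈-weaken x∈))

  sx≢n : s x ≢ suc m
  sx≢n eq = <⇒≢ (s≤s (proj₂ x∈)) (inj S (∈-weaken x∈) (s≤s z≤n , ≤-refl) (trans eq (sym fix)))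

-- Assuming an intertwining relation, instead of a formula for `s′`, lets the same module serve both
-- directions: `s` and `s′` trade places together with a and b.
module Covers (a b : ℕ) (1≤a : 1 ≤ a) (1≤b : 1 ≤ b) {s s′ : ℕ → ℕ}
  (S : PermOn (suc (a + b)) s) (s-fix : s (suc (a + b)) ≡ suc (a + b))
  (s′-fix : s′ (suc (a + b)) ≡ suc (a + b))
  (intertwine : ∀ {x} → x ∈[ a + b ] → s′ (rot a b x) ≡ rot a b (s x)) where

  private
    m = a + b
    ρ = rot a b
    ρ⁻¹ = rot b a

    b+a≡m : b + a ≡ m
    b+a≡m = +-comm b a

    m∈ : m ∈[ m ]
    m∈ = ≤-trans 1≤a (m≤m+n a b) , ≤-refl

    a∈ : a ∈[ m ]
    a∈ = 1≤a , m≤m+n a b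

    top∈ : suc m ∈[ suc m ]
    top∈ = s≤s z≤n , ≤-refl

    ρ-∈ : ∀ {x} → x ∈[ m ] → ρ x ∈[ m ]
    ρ-∈ = rot-∈ a b

    ρ⁻¹-∈ : ∀ {x} → x ∈[ m ] → ρ⁻¹ x ∈[ m ]
    ρ⁻¹-∈ {x} x∈ = subst (ρ⁻¹ x ∈[_]) b+a≡m (rot-∈ b a (subst (x ∈[_]) (sym b+a≡m) x∈))

    ρ-a : ρ a ≡ m
    ρ-a = trans (rot-low a b ≤-refl) b+a≡m

    ρ-m : ρ m ≡ b
    ρ-m = rot-high a b 1≤b ≤-refl

    s-∈ : ∀ {x} → x ∈[ m ] → s x ∈[ m ]
    s-∈ = fixes-top⇒maps S s-fix

    extend-image : ∀ v {x y} → x ≡ s y → y ∈[ m ] → extend m ρ v x ≡ s′ (ρ y)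
    extend-image v refl y∈ = trans (extend-≤ ρ v (proj₂ (s-∈ y∈))) (sym (intertwine y∈))

    extend-ψ : ∀ v u {h y} → y ∈[ m ] → h ⊢ extend m ρ v (extend m ρ⁻¹ u y) ↝ y
    extend-ψ v u {h} {y} y∈ = ↝-reflexive (trans (cong (extend m ρ v) (extend-≤ ρ⁻¹ u (proj₂ y∈)))
      (trans (extend-≤ ρ v (proj₂ (ρ⁻¹-∈ y∈))) (rot-inverse b a (proj₁ y∈))))

  module _ {f h : ℕ → ℕ}
    (f-eq : ∀ {x} → x ∈[ suc m ] → f x ≡ s (swap m x))
    (h-eq : ∀ {x} → x ∈[ suc m ] → h x ≡ s′ (swap m x)) where

    private
      -- `f` sends m to the root, so the root shares the image of m and this step of `f` collapses
      -- under `φ`.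
      φ = extend m ρ (ρ m)

      h-m : h m ≡ suc m
      h-m = trans (h-eq (∈-weaken m∈)) (trans (cong s′ (swap-m m)) s′-fix)

      h-↝ : ∀ {y} → y ∈[ m ] → h ⊢ y ↝ s′ y
      h-↝ {y} y∈ with y ≟ m
      ... | no y≢m   = ↝-step (trans (h-eq (∈-weaken y∈)) (cong s′ (swap-< (≤∧≢⇒< (proj₂ y∈) y≢m))))
      -- From m, `h` reaches `s′ m` in two steps, through the root.
      ... | yes refl = ↝-trans (↝-step h-m) (↝-step (trans (h-eq top∈) (cong s′ (swap-suc m))))

      step : ∀ {x} → x ∈[ suc m ] → h ⊢ φ x ↝ φ (f x)
      step x∈ with trichotomy x∈
      ... | below {x} 1≤x x<m = subst₂ (h ⊢_↝_) (sym (extend-≤ ρ _ (<⇒≤ x<m)))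
        (sym (extend-image _ (trans (f-eq x∈) (cong s (swap-< x<m))) (1≤x , <⇒≤ x<m)))
        (h-↝ (ρ-∈ (1≤x , <⇒≤ x<m)))
      ... | above = subst₂ (h ⊢_↝_) (sym (extend-top m ρ _))
        (sym (extend-image _ (trans (f-eq x∈) (cong s (swap-suc m))) m∈))
        (h-↝ (ρ-∈ m∈))
      ... | at = ↝-reflexive (trans (extend-≤ {m} {m} ρ (ρ m) ≤-refl) (sym (trans
        (cong φ (trans (f-eq x∈) (trans (cong s (swap-m m)) s-fix))) (extend-top m ρ _))))

      φψ : ∀ {y} → y ∈[ suc m ] → h ⊢ φ (extend m ρ⁻¹ a y) ↝ y
      φψ y∈ with topView y∈
      ... | under y∈′ = extend-ψ (ρ m) a y∈′
      -- The root is pulled back to a because `ρ a` is m, and `h` sends m to the root.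
      ... | top = ↝-trans (↝-reflexive (trans (cong φ (extend-top m ρ⁻¹ a))
        (trans (extend-≤ ρ _ (proj₂ a∈)) ρ-a))) (↝-step h-m)

    swap-cover : OrbitCover (suc m) f h φ (extend m ρ⁻¹ a)
    swap-cover = record
      { φ-∈ = extend-∈ ρ-∈ (ρ-∈ m∈) ; φ-step = step ; ψ-∈ = extend-∈ ρ⁻¹-∈ a∈ ; φ-ψ = φψ }

  module _ {f h : ℕ → ℕ}
    (f-eq : ∀ {x} → x ∈[ suc m ] → f x ≡ s (splitCycle m a x))
    (h-eq : ∀ {x} → x ∈[ suc m ] → h x ≡ s′ (splitCycle m b x)) where

    private
      -- Here `f` sends a to the root, so the root gets the image `ρ a`, which is m.
      φ = extend m ρ m

      b∈ : b ∈[ m ]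
      b∈ = 1≤b , m≤n+m b a

      h-b : h b ≡ suc m
      h-b = trans (h-eq (∈-weaken b∈)) (trans (cong s′ (splitCycle-a b a b+a≡m 1≤b 1≤a)) s′-fix)

      h-↝ : ∀ {x y z} → x ∈[ suc m ] → splitCycle m a x ≡ y → y ∈[ m ] →
        z ∈[ suc m ] → splitCycle m b z ≡ ρ y → h ⊢ z ↝ φ (f x)
      h-↝ x∈ refl y∈ z∈ eq = ↝-step (trans (trans (h-eq z∈) (cong s′ eq))
        (sym (extend-image m (f-eq x∈) y∈)))

      step-under : ∀ {x} → x ∈[ m ] → h ⊢ ρ x ↝ φ (f x)
      step-under x∈ with blocks a b x∈
      ... | low {x} 1≤x x≤a with x ≟ a
      ...   | yes refl = ↝-reflexive (trans ρ-a (sym (trans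
        (cong φ (trans (f-eq (∈-weaken x∈)) (trans (cong s (splitCycle-a a b refl 1≤a 1≤b)) s-fix)))
        (extend-top m ρ m))))
      ...   | no x≢a = h-↝ (∈-weaken x∈) (splitCycle-low a b refl 1≤a 1≤b 1≤x x<a)
        (s≤s z≤n , ≤-trans x<a (m≤m+n a b)) (∈-weaken (ρ-∈ x∈))
        (trans (cong (splitCycle m b) (rot-low a b x≤a))
          (trans (splitCycle-high b a b+a≡m 1≤b 1≤a (m<m+n b 1≤x) (subst (b + x <_) b+a≡m (+-monoʳ-< b x<a)))
            (trans (sym (+-suc b x)) (sym (rot-low a b x<a)))))
        where x<a = ≤∧≢⇒< x≤a x≢a
      step-under x∈ | high {k} 1≤k k≤b with k ≟ b
      -- For `h` the root lies in the image of the second block. The step of `f` that closes this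
      -- block, from m to `s (a+1)`, becomes two steps of `h`: from b to the root, then to `s′ 1`.
      ...   | yes refl = subst (h ⊢_↝ φ (f m)) (sym ρ-m) (↝-trans (↝-step h-b)
        (h-↝ (∈-weaken m∈) (trans (splitCycle-m a b refl 1≤a 1≤b) (+-comm 1 a))
          (m≤n+m 1 a , +-monoʳ-≤ a 1≤b) top∈
          (trans (splitCycle-root b a b+a≡m 1≤b 1≤a) (sym (rot-high a b ≤-refl 1≤b)))))
      ...   | no k≢b = h-↝ (∈-weaken x∈)
        (trans (splitCycle-high a b refl 1≤a 1≤b (m<m+n a 1≤k) (+-monoʳ-< a k<b)) (sym (+-suc a k)))
        (≤-trans (s≤s z≤n) (m≤n+m (suc k) a) , +-monoʳ-≤ a k<b) (∈-weaken (ρ-∈ x∈))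
        (trans (cong (splitCycle m b) (rot-high a b 1≤k k≤b))
          (trans (splitCycle-low b a b+a≡m 1≤b 1≤a 1≤k k<b) (sym (rot-high a b (s≤s z≤n) k<b))))
        where k<b = ≤∧≢⇒< k≤b k≢b

      step : ∀ {x} → x ∈[ suc m ] → h ⊢ φ x ↝ φ (f x)
      step {x} x∈ with topView x∈
      ... | under x∈′ = subst (h ⊢_↝ φ (f x)) (sym (extend-≤ ρ m (proj₂ x∈′))) (step-under x∈′)
      ... | top = subst (h ⊢_↝ φ (f (suc m))) (sym (extend-top m ρ m))
        (h-↝ x∈ (splitCycle-root a b refl 1≤a 1≤b) (≤-refl , proj₁ m∈) (∈-weaken m∈)
          (trans (splitCycle-m b a b+a≡m 1≤b 1≤a) (trans (+-comm 1 b) (sym (rot-low a b 1≤a)))))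

      φψ : ∀ {y} → y ∈[ suc m ] → h ⊢ φ (extend m ρ⁻¹ m y) ↝ y
      φψ y∈ with topView y∈
      ... | under y∈′ = extend-ψ m m y∈′
      ... | top = ↝-trans (↝-reflexive (trans (cong φ (extend-top m ρ⁻¹ m))
        (trans (extend-≤ {m} {m} ρ m ≤-refl) ρ-m))) (↝-step h-b)

    splitCycle-cover : OrbitCover (suc m) f h φ (extend m ρ⁻¹ m)
    splitCycle-cover = record
      { φ-∈ = extend-∈ ρ-∈ m∈ ; φ-step = step ; ψ-∈ = extend-∈ ρ⁻¹-∈ m∈ ; φ-ψ = φψ }

-- Keeping `m` apart from `a + b` lets the instance with a and b exchanged speak of the same `m`.
splitCycle-count-≤ : ∀ {m} a b → a + b ≡ m → 1 ≤ a → 1 ≤ b → {s s′ f h : ℕ → ℕ} →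
  PermOn (suc m) s → s (suc m) ≡ suc m → s′ (suc m) ≡ suc m →
  (∀ {x} → x ∈[ m ] → s′ (rot a b x) ≡ rot a b (s x)) →
  PermOn (suc m) f → (∀ {x} → x ∈[ suc m ] → f x ≡ s (splitCycle m a x)) →
  PermOn (suc m) h → (∀ {x} → x ∈[ suc m ] → h x ≡ s′ (splitCycle m b x)) →
  cycleCount (suc m) h ≤ cycleCount (suc m) f
splitCycle-count-≤ a b refl 1≤a 1≤b {s} {s′} S s-fix s′-fix intertwine F f-eq H h-eq =
  cycleCount-cover F H (Covers.splitCycle-cover a b 1≤a 1≤b {s} {s′} S s-fix s′-fix intertwine f-eq h-eq)

rot-permOn : ∀ a b → PermOn (suc (a + b)) (rot a b)
rot-permOn a b = inverse-permOn {g = rot b a} into (rot-inverse a b ∘ proj₁)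
  where
  into : ∀ {x} → x ∈[ suc (a + b) ] → rot a b x ∈[ suc (a + b) ]
  into x∈ with topView x∈
  ... | under x∈′ = ∈-weaken (rot-∈ a b x∈′)
  ... | top       = subst (_∈[ suc (a + b) ]) (sym (rot-above a b ≤-refl)) x∈

-- The bijection on dipoles

Good : ℕ → ℕ → ℕ → (ℕ → ℕ) → Set
Good n q g σ = SingleOrbit n σ × σ (n ∸ 1) ≡ n × cycleCount n (σ ∘ Cq n q) + 2 * g ≡ n

-- The predicate local to `N`, with its parameters explicit; both unfold to the same term, so `N`
-- counts it by definition.
goodᵇ : ℕ → ℕ → ℕ → List ℕ → Bool
goodᵇ n q g w = isPerm n w ∧ isNCycle n (apply w) ∧ (apply w (n ∸ 1) ≡ᵇ n)
  ∧ (cycleCount n (λ x → apply w (Cq n q x)) + 2 * g ≡ᵇ n)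

private
  T-∧⁴⁻ : ∀ b₁ b₂ b₃ b₄ → T (b₁ ∧ b₂ ∧ b₃ ∧ b₄) → T b₁ × T b₂ × T b₃ × T b₄
  T-∧⁴⁻ true true true true _ = _

  T-∧⁴⁺ : ∀ b₁ b₂ b₃ b₄ → T b₁ → T b₂ → T b₃ → T b₄ → T (b₁ ∧ b₂ ∧ b₃ ∧ b₄)
  T-∧⁴⁺ true true true true _ _ _ _ = _

goodᵇ⁻ : ∀ {n q g w} → w ∈ words n n → T (goodᵇ n q g w) → PermOn n (apply w) × Good n q g (apply w)
goodᵇ⁻ {n} {q} {g} {w} w∈ t =
  let perm , cyc , jump , count = T-∧⁴⁻ (isPerm n w) (isNCycle n (apply w)) (apply w (n ∸ 1) ≡ᵇ n)
        (cycleCount n (λ x → apply w (Cq n q x)) + 2 * g ≡ᵇ n) t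
  in isPerm⁻ w∈ perm , isNCycle⁻ {n} {apply w} cyc , ≡ᵇ⇒≡ (apply w (n ∸ 1)) n jump ,
     ≡ᵇ⇒≡ (cycleCount n (λ x → apply w (Cq n q x)) + 2 * g) n count

goodᵇ⁺ : ∀ {n q g w} → 1 ≤ n → PermOn n (apply w) → Good n q g (apply w) → T (goodᵇ n q g w)
goodᵇ⁺ {n} {q} {g} {w} 1≤n W (single , jump , count) =
  T-∧⁴⁺ (isPerm n w) (isNCycle n (apply w)) (apply w (n ∸ 1) ≡ᵇ n)
    (cycleCount n (λ x → apply w (Cq n q x)) + 2 * g ≡ᵇ n)
    (isPerm⁺ {n} {w} W) (isNCycle⁺ W 1≤n single) (≡⇒≡ᵇ (apply w (n ∸ 1)) n jump)
    (≡⇒≡ᵇ (cycleCount n (λ x → apply w (Cq n q x)) + 2 * g) n count)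

-- Conjugates s = σ ∘ (m, m+1) by the rotation, then multiplies (m, m+1) back.
transport : ℕ → ℕ → (ℕ → ℕ) → ℕ → ℕ
transport a b σ x = rot a b (σ (swap (a + b) (rot b a (swap (a + b) x))))

module _ (a b : ℕ) (1≤a : 1 ≤ a) (1≤b : 1 ≤ b) where

  private
    m = a + b
    n = suc m

    1≤m : 1 ≤ m
    1≤m = ≤-trans 1≤a (m≤m+n a b)

    top∈ : n ∈[ n ]
    top∈ = s≤s z≤n , ≤-refl

    rot⁻¹-permOn : PermOn n (rot b a)
    rot⁻¹-permOn = subst (λ k → PermOn (suc k) (rot b a)) (+-comm b a) (rot-permOn b a)

  transport-permOn : ∀ {σ} → PermOn n σ → PermOn n (transport a b σ)
  transport-permOn Σ = ∘-permOn (rot-permOn a b) (∘-permOn Σ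
    (∘-permOn (swap-permOn 1≤m) (∘-permOn rot⁻¹-permOn (swap-permOn 1≤m))))

  transport-injective : ∀ {σ τ} → PermOn n σ → PermOn n τ →
    (∀ {x} → x ∈[ n ] → transport a b σ x ≡ transport a b τ x) → ∀ {x} → x ∈[ n ] → σ x ≡ τ x
  transport-injective {σ} {τ} Σ Τ eq {x} x∈ =
    trans (sym (undo σ Σ)) (trans (cong (rot b a) (eq {y} y∈)) (undo τ Τ))
    where
    -- The argument at which `transport` reads off the value at `x`.
    y : ℕ
    y = swap m (rot a b (swap m x))

    y∈ : y ∈[ n ]
    y∈ = swap-∈ 1≤m (maps (rot-permOn a b) (swap-∈ 1≤m x∈))

    y↦x : swap m (rot b a (swap m y)) ≡ x
    y↦x = trans (cong (λ z → swap m (rot b a z)) (swap-involutive m (rot a b (swap m x))))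
      (trans (cong (swap m) (rot-inverse a b {swap m x} (proj₁ (swap-∈ 1≤m x∈)))) (swap-involutive m x))

    undo : ∀ σ → PermOn n σ → rot b a (transport a b σ y) ≡ σ x
    undo σ Σ = trans (cong (λ z → rot b a (rot a b (σ z))) y↦x)
      (rot-inverse a b {σ x} (proj₁ (maps Σ x∈)))

  -- `σ′` is prescribed on [n] alone because it will be the map of a tabulated word.
  module _ {σ σ′ : ℕ → ℕ} (Σ : PermOn n σ) (σ-jump : σ m ≡ n)
    (σ′-eq : ∀ {x} → x ∈[ n ] → σ′ x ≡ transport a b σ x) where

    private
      s s′ : ℕ → ℕ
      s  x = σ (swap m x)
      s′ x = rot a b (s (rot b a x))

      S : PermOn n s
      S = ∘-permOn Σ (swap-permOn 1≤m)

      S′ : PermOn n s′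
      S′ = ∘-permOn (rot-permOn a b) (∘-permOn S rot⁻¹-permOn)

      Σ′ : PermOn n σ′
      Σ′ = permOn-resp σ′-eq (transport-permOn Σ)

      s-fix : s n ≡ n
      s-fix = trans (cong σ (swap-suc m)) σ-jump

      s′-fix : s′ n ≡ n
      s′-fix = trans (cong (rot a b ∘ s) (rot-above b a (≤-reflexive (cong suc (+-comm b a)))))
        (trans (cong (rot a b) s-fix) (rot-above a b ≤-refl))

      intertwine : ∀ {x} → x ∈[ m ] → s′ (rot a b x) ≡ rot a b (s x)
      intertwine {x} x∈ = cong (λ z → rot a b (s z)) (rot-inverse a b {x} (proj₁ x∈))

      intertwine⁻¹ : ∀ {x} → x ∈[ n ] → s (rot b a x) ≡ rot b a (s′ x)
      intertwine⁻¹ {x} x∈ = sym (rot-inverse a b {s (rot b a x)} (proj₁ (maps S (maps rot⁻¹-permOn x∈))))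

      σ-swap : ∀ x → σ x ≡ s (swap m x)
      σ-swap x = cong σ (sym (swap-involutive m x))

      C-a : PermOn n (Cq n (suc a))
      C-a = Cq-permOn a b refl 1≤a 1≤b

      C-b : PermOn n (Cq n (suc b))
      C-b = Cq-permOn b a (+-comm b a) 1≤b 1≤a

      σ′-split : ∀ {x} → x ∈[ n ] → σ′ (Cq n (suc b) x) ≡ s′ (splitCycle m b x)
      -- `transport` unfolds to `s′` after `swap`, and `swap` after C_q is `splitCycle` by
      -- definition.
      σ′-split x∈ = σ′-eq (maps C-b x∈)

      count-≡ : cycleCount n (σ′ ∘ Cq n (suc b)) ≡ cycleCount n (σ ∘ Cq n (suc a))
      count-≡ = ≤-antisym
        (splitCycle-count-≤ a b refl 1≤a 1≤b {s} {s′} S s-fix s′-fix intertwine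
          (∘-permOn Σ C-a) (λ _ → σ-swap _) (∘-permOn Σ′ C-b) σ′-split)
        (splitCycle-count-≤ b a (+-comm b a) 1≤b 1≤a {s′} {s} S′ s′-fix s-fix (intertwine⁻¹ ∘ ∈-weaken)
          (∘-permOn Σ′ C-b) σ′-split (∘-permOn Σ C-a) (λ _ → σ-swap _))

    transport-good : ∀ {g} → Good n (suc a) g σ → Good n (suc b) g σ′
    transport-good {g} (single , jump , count) =
      singleOrbit-cover Σ Σ′
        (Covers.swap-cover a b 1≤a 1≤b {s} {s′} S s-fix s′-fix intertwine (λ _ → σ-swap _) σ′-eq) (s≤s z≤n) single ,
      trans (σ′-eq (∈-weaken (1≤m , ≤-refl))) (trans (cong s′ (swap-m m)) s′-fix) ,
      trans (cong (_+ 2 * g) count-≡) count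

N-≤ : ∀ {m} a b → a + b ≡ m → 1 ≤ a → 1 ≤ b → ∀ g → N (suc m) (suc a) g ≤ N (suc m) (suc b) g
N-≤ a b refl 1≤a 1≤b g = length-filter-injection F
    (λ w → T? (goodᵇ n (suc a) g w)) (λ w → T? (goodᵇ n (suc b) g w)) (words-unique n n) into injective
  where
  n = suc (a + b)

  F : List ℕ → List ℕ
  F w = tabulateWord n (transport a b (apply w))

  apply-F : ∀ w {x} → x ∈[ n ] → apply (F w) x ≡ transport a b (apply w) x
  apply-F w = apply-tabulateWord n (transport a b (apply w))

  into : ∀ {w} → w ∈ words n n → T (goodᵇ n (suc a) g w) → F w ∈ words n n × T (goodᵇ n (suc b) g (F w))
  into {w} w∈ t =
    let W , good@(_ , jump , _) = goodᵇ⁻ {n} {suc a} {g} {w} w∈ t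
        W′ = transport-permOn a b 1≤a 1≤b W
    in tabulateWord-∈-words n (maps W′) ,
       goodᵇ⁺ {n} {suc b} {g} {F w} (s≤s z≤n) (permOn-resp (apply-F w) W′)
         (transport-good a b 1≤a 1≤b {apply w} {apply (F w)} W jump (apply-F w) {g} good)

  injective : ∀ {v w} → v ∈ words n n → T (goodᵇ n (suc a) g v) → w ∈ words n n → T (goodᵇ n (suc a) g w) →
    F v ≡ F w → v ≡ w
  injective {v} {w} v∈ tv w∈ tw eq =
    let |v|≡n , _ = ∈-words⁻ n v∈ ; |w|≡n , _ = ∈-words⁻ n w∈
        V , _ = goodᵇ⁻ {n} {suc a} {g} {v} v∈ tv
        W , _ = goodᵇ⁻ {n} {suc a} {g} {w} w∈ tw
    in apply-ext v w (trans |v|≡n (sym |w|≡n)) λ {i} i∈ →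
      transport-injective a b 1≤a 1≤b {apply v} {apply w} V W
        (λ {x} x∈ → trans (sym (apply-F v x∈)) (trans (cong (λ u → apply u x) eq) (apply-F w x∈)))
        (subst (i ∈[_]) |v|≡n i∈)

mainTheorem10 : (n p p' : ℕ) → 3 ≤ n → 2 ≤ p → p ≤ n ∸ 1 → p + p' ≡ n + 1 →
    (g : ℕ) → N n p g ≡ N n p' g
mainTheorem10 (suc m) (suc a) zero _ _ a<m p+p'≡ g =
  -- A vanishing second parameter would force p = n + 1.
  contradiction (trans (sym (+-identityʳ a)) (trans (suc-injective p+p'≡) (+-comm m 1))) (<⇒≢ (m<n⇒m<1+n a<m))
mainTheorem10 (suc m) (suc a) (suc b) _ (s≤s 1≤a) a<m p+p'≡ g =
  ≤-antisym (N-≤ a b a+b≡m 1≤a 1≤b g) (N-≤ b a (trans (+-comm b a) a+b≡m) 1≤b 1≤a g)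
  where
  a+b≡m : a + b ≡ m
  a+b≡m = suc-injective (trans (sym (+-suc a b)) (trans (suc-injective p+p'≡) (+-comm m 1)))

  1≤b : 1 ≤ b
  -- The bound p ≤ n - 1 reads a < m, which makes the second block nonempty.
  1≤b = +-cancelˡ-< a 0 b (subst₂ _<_ (sym (+-identityʳ a)) (sym a+b≡m) a<m)
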